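{- Let $n$ and $k$ be positive integers with $k>1$ and $n\geqslant k(k+1)$. Then the total Roman domination number of the Kneser graph $K_{n,k}$ satisfies $\gamma_{tR}(K_{n,k}) = 2(k+1)$.
   Context: For positive integers $n,k$, the Kneser graph $K_{n,k}$ is the simple graph whose vertices are all $k$-element subsets of $\{1,2,\dots,n\}$, two vertices being adjacent if and only if the corresponding sets are disjoint. Let $G=(V,E)$ be a finite simple graph and, for $v\in V$, let $N(v)=\{u\in V \mid uv\in E\}$ be the open neighborhood of $v$. A total Roman domination function (TRDF) on $G$ is a function $f:V\to\{0,1,2\}$ such that: (1) every vertex $v$ with $f(v)=0$ has a neighbor $u$ with $f(u)=2$; and (2) for every $v\in V$, $\sum_{u\in N(v)}f(u)\geqslant 1$. The weight of $f$ is $f(V)=\sum_{v\in V}f(v)$. The total Roman domination number $\gamma_{tR}(G)$ is the minimum weight over all TRDFs on $G$. -}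

module Defs where

open import Data.Fin.Base using (Fin; toℕ)
open import Data.Fin.Patterns using (0F; 2F)
open import Data.Fin.Subset using (Subset; inside; outside; _∩_; ∣_∣; Empty)
open import Data.Fin.Subset.Properties using (nonempty?; ∩-comm; ∩-idem; Empty-unique; ∣⊥∣≡0)
open import Data.List.Base using (List; []; _∷_; map; _++_; filter; sum)
open import Data.List.Membership.Propositional using (_∈_)
open import Data.List.Membership.Propositional.Properties using (∈-map⁺; ∈-map⁻; ∈-++⁺ˡ; ∈-++⁺ʳ)
open import Data.List.Relation.Unary.All using ([])
open import Data.List.Relation.Unary.AllPairs using ([]; _∷_)
open import Data.List.Relation.Unary.Any using (here)
open import Data.List.Relation.Unary.Unique.Propositional using (Unique)
import Data.List.Relation.Unary.Unique.Propositional.Properties as Unique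
open import Data.List.Relation.Binary.Disjoint.Propositional using (Disjoint)
open import Data.Nat.Base using (ℕ; zero; suc; _≤_; NonZero; ≢-nonZero⁻¹)
open import Data.Nat.Properties using (≡-irrelevant; suc-injective; ≤-antisym)
open import Data.Product.Base using (Σ-syntax; ∃-syntax; _×_; _,_; proj₁)
open import Data.Vec.Base using ([]; _∷_)
open import Data.Vec.Properties using (∷-injectiveˡ; ∷-injectiveʳ)
open import Function.Base using (_∘_)
open import Relation.Binary.Core using (Rel)
open import Relation.Binary.Definitions using (Symmetric; Irreflexive; Decidable)
open import Relation.Binary.PropositionalEquality using (_≡_; refl; sym; trans; cong; subst)
open import Relation.Nullary.Decidable using (¬?)
open import Level using (0ℓ)

-- Finiteness is a duplicate-free list of all vertices; sums over vertices do
-- not depend on the order in which it lists them.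

record FiniteSimpleGraph : Set₁ where
  infix 4 _~_ _~?_
  field
    V        : Set
    vertices : List V
    complete : ∀ v → v ∈ vertices
    unique   : Unique vertices
    _~_      : Rel V 0ℓ
    _~?_     : Decidable _~_
    ~-sym    : Symmetric _~_
    ~-irrefl : Irreflexive _≡_ _~_

  N : V → List V
  N v = filter (v ~?_) vertices

module _ (G : FiniteSimpleGraph) where
  open FiniteSimpleGraph G

  weight : (V → Fin 3) → ℕ
  weight f = sum (map (toℕ ∘ f) vertices)

  record IsTRDF (f : V → Fin 3) : Set where
    field
      roman : ∀ v → f v ≡ 0F → ∃[ u ] v ~ u × f u ≡ 2F
      total : ∀ v → 1 ≤ sum (map (toℕ ∘ f) (N v))

  -- γtR is partial (a graph with an isolated vertex has no TRDF), so it is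
  -- a relation: γtR≡ m says that the minimum exists and equals m.
  record γtR≡ (m : ℕ) : Set where
    field
      attained : ∃[ f ] IsTRDF f × weight f ≡ m
      minimal  : ∀ f → IsTRDF f → m ≤ weight f

  γtR-functional : ∀ {m m′} → γtR≡ m → γtR≡ m′ → m ≡ m′
  γtR-functional
    record { attained = f , tf , refl ; minimal = min }
    record { attained = g , tg , refl ; minimal = min′ } =
    ≤-antisym (min g tg) (min′ f tf)

KSubset : ℕ → ℕ → Set
KSubset n k = Σ[ p ∈ Subset n ] ∣ p ∣ ≡ k

KSubset-≡ : ∀ {n k} {s t : KSubset n k} → proj₁ s ≡ proj₁ t → s ≡ t
KSubset-≡ {s = p , e} {t = .p , e′} refl = cong (p ,_) (≡-irrelevant e e′)

consIn : ∀ {n k} → KSubset n k → KSubset (suc n) (suc k)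
consIn (p , e) = inside ∷ p , cong suc e

consOut : ∀ {n k} → KSubset n k → KSubset (suc n) k
consOut (p , e) = outside ∷ p , e

consIn-injective : ∀ {n k} {s t : KSubset n k} → consIn s ≡ consIn t → s ≡ t
consIn-injective eq = KSubset-≡ (∷-injectiveʳ (cong proj₁ eq))

consOut-injective : ∀ {n k} {s t : KSubset n k} → consOut s ≡ consOut t → s ≡ t
consOut-injective eq = KSubset-≡ (∷-injectiveʳ (cong proj₁ eq))

kSubsets : ∀ n k → List (KSubset n k)
kSubsets zero    zero    = ([] , refl) ∷ []
kSubsets zero    (suc k) = []
kSubsets (suc n) zero    = map consOut (kSubsets n zero)
kSubsets (suc n) (suc k) =
  map consIn (kSubsets n k) ++ map consOut (kSubsets n (suc k))

kSubsets-complete : ∀ n k (s : KSubset n k) → s ∈ kSubsets n k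
kSubsets-complete zero zero ([] , refl) = here refl
kSubsets-complete (suc n) zero (outside ∷ p , e) =
  ∈-map⁺ consOut (kSubsets-complete n zero (p , e))
kSubsets-complete (suc n) (suc k) (inside ∷ p , e) =
  subst (_∈ kSubsets (suc n) (suc k)) (KSubset-≡ refl)
    (∈-++⁺ˡ (∈-map⁺ consIn (kSubsets-complete n k (p , suc-injective e))))
kSubsets-complete (suc n) (suc k) (outside ∷ p , e) =
  ∈-++⁺ʳ (map consIn (kSubsets n k))
    (∈-map⁺ consOut (kSubsets-complete n (suc k) (p , e)))

consIn-consOut-disjoint : ∀ {n k} {xs : List (KSubset n k)} {ys} →
                          Disjoint (map consIn xs) (map consOut ys)
consIn-consOut-disjoint (i , o) with ∈-map⁻ consIn i | ∈-map⁻ consOut o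
... | _ , _ , refl | _ , _ , eq with ∷-injectiveˡ (cong proj₁ eq)
... | ()

kSubsets-unique : ∀ n k → Unique (kSubsets n k)
kSubsets-unique zero    zero    = [] ∷ []
kSubsets-unique zero    (suc k) = []
kSubsets-unique (suc n) zero    = Unique.map⁺ consOut-injective (kSubsets-unique n zero)
kSubsets-unique (suc n) (suc k) = Unique.++⁺
  (Unique.map⁺ consIn-injective (kSubsets-unique n k))
  (Unique.map⁺ consOut-injective (kSubsets-unique n (suc k)))
  consIn-consOut-disjoint

-- For k = 0 the empty set would be adjacent to itself, hence NonZero k.
Kneser : (n k : ℕ) → .{{NonZero k}} → FiniteSimpleGraph
Kneser n k = record
  { V        = KSubset n k
  ; vertices = kSubsets n k
  ; complete = kSubsets-complete n k
  ; unique   = kSubsets-unique n k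
  ; _~_      = λ (p , _) (q , _) → Empty (p ∩ q)
  ; _~?_     = λ (p , _) (q , _) → ¬? (nonempty? (p ∩ q))
  ; ~-sym    = λ { {p , _} {q , _} → subst Empty (∩-comm p q) }
  ; ~-irrefl = λ { {p , e} refl p∩p-empty → ≢-nonZero⁻¹ k
      (trans (sym e)
        (trans (cong ∣_∣ (Empty-unique (subst Empty (∩-idem p) p∩p-empty)))
          (∣⊥∣≡0 n))) }
  }

{-# OPTIONS --safe #-}

-- Upper bound: n ≥ k(k+1) leaves room for k+1 pairwise disjoint k-sets; give
-- each of them the value 2. A k-set meets at most k of them, so every vertex
-- has a neighbour of value 2.
--
-- Lower bound: a vertex meeting all vertices of value 2 has positive value. If
-- some (k-1)-set S meets all of them, then all n-k+1 k-sets containing S have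
-- positive value, and so has a neighbour of one of these k-sets, which cannot
-- contain S; hence the weight is at least n-k+2 ≥ k²+2 ≥ 2k+2. Such an S exists
-- if there are fewer than k vertices of value 2, or exactly k, one of which, A,
-- shares a point with another. If there are exactly k and A is disjoint from
-- the others, let S meet those others. Either S also meets A, or S ∪ {x} and
-- S ∪ {y} with distinct x, y ∈ A are two vertices of positive value beyond
-- the k vertices of value 2.

module Submission where

open import Defs
open import Data.Bool.Properties using () renaming (_≟_ to _≟ᵇ_)
open import Data.Fin.Base using (Fin; zero; suc; toℕ)
open import Data.Fin.Patterns using (0F; 1F; 2F)
import Data.Fin.Properties as Fin
open import Data.Fin.Subset
  using (Subset; inside; outside; _∩_; _∪_; _-_; ⊤; ⊥; ⁅_⁆; ∣_∣; Empty; Nonempty; _⊆_)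
  renaming (_∈_ to _∈ₛ_; _∉_ to _∉ₛ_)
open import Data.Fin.Subset.Properties
  using (nonempty?; Empty-unique; ∣⊥∣≡0; ∣⊤∣≡n; ⊆⊤; ∉⊥; s⊆s; out⊆; p⊆p∪q; q⊆p∪q;
         x∈p∪q⁻; x∈p∩q⁺; x∈p∩q⁻; x∈⁅x⁆; x∈⁅y⁆⇒x≡y; x∈p∧x≢y⇒x∈p-y;
         x∈p⇒∣p-x∣<∣p∣; ∪-identityˡ)
open import Data.List.Base using (List; []; _∷_; map; _++_; filter; length)
open import Data.List.Membership.Propositional using (_∈_; _∉_; find; lose)
open import Data.List.Membership.Propositional.Properties
  using (∈-∃++; ∈-++⁻; ∈-++⁺ˡ; ∈-++⁺ʳ; ∈-filter⁺; ∈-filter⁻)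
import Data.List.Membership.DecPropositional as DecMembership
open import Data.List.Properties using (length-map)
open import Data.List.Relation.Unary.All as All using (All; []; _∷_)
import Data.List.Relation.Unary.All.Properties as All
open import Data.List.Relation.Unary.AllPairs as AllPairs using (AllPairs; []; _∷_)
import Data.List.Relation.Unary.AllPairs.Properties as AllPairs
open import Data.List.Relation.Unary.Any as Any using (here; there)
open import Data.List.Relation.Unary.Unique.Propositional using (Unique)
import Data.List.Relation.Unary.Unique.Propositional.Properties as Unique
open import Data.Nat.Base
  using (ℕ; zero; suc; _+_; _*_; _∸_; _≤_; _<_; _≥_; z≤n; s≤s; s≤s⁻¹; NonZero)
open import Data.Nat.ListAction using (sum)
open import Data.Nat.Properties
open import Data.Nat.Tactic.RingSolver using (solve-∀)
open import Data.Product.Base using (∃-syntax; _×_; _,_; proj₁; proj₂)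
open import Data.Sum.Base using (inj₁; inj₂)
open import Data.Vec.Base using ([]; _∷_; here; there)
open import Data.Vec.Properties using (≡-dec)
open import Function.Base using (_∘_)
open import Relation.Binary.Definitions using (DecidableEquality)
open import Relation.Binary.PropositionalEquality
  using (_≡_; _≢_; refl; sym; trans; cong; subst; subst₂)
open import Relation.Nullary using (¬_; yes; no; contradiction)
open import Relation.Nullary.Decidable using (map′; decidable-stable)

-- Sums over lists

module _ {A : Set} (g : A → ℕ) where

  sum-insert : ∀ as {v} bs →
    sum (map g (as ++ v ∷ bs)) ≡ g v + sum (map g (as ++ bs))
  sum-insert []       bs = refl
  sum-insert (a ∷ as) {v} bs rewrite sum-insert as {v} bs =
    swap (g a) (g v) (sum (map g (as ++ bs)))
    where
    swap : ∀ x y z → x + (y + z) ≡ y + (x + z)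
    swap = solve-∀

  -- Each `u` of nonzero value is cut out of `vs`; since `us` has no repeats, its later entries are
  -- still found in what remains. As membership is asked only on the support of `g`, this bounds a
  -- partial sum by the weight and also the weight by the sum over the support.
  sum-mono-support : ∀ {us vs} → Unique us → (∀ {u} → u ∈ us → g u ≢ 0 → u ∈ vs) →
    sum (map g us) ≤ sum (map g vs)
  sum-mono-support {[]} [] _ = z≤n
  sum-mono-support {u ∷ us} {vs} (u∉us ∷ uniq) sub with g u ≟ 0
  ... | yes gu≡0 rewrite gu≡0 = sum-mono-support uniq (sub ∘ there)
  ... | no gu≢0 with ∈-∃++ (sub (here refl) gu≢0)
  ...   | as , bs , refl = ≤-trans
    (+-monoʳ-≤ (g u) (sum-mono-support uniq sub′))
    (≤-reflexive (sym (sum-insert as bs)))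
    where
    sub′ : ∀ {w} → w ∈ us → g w ≢ 0 → w ∈ as ++ bs
    sub′ w∈us gw≢0 with ∈-++⁻ as (sub (there w∈us) gw≢0)
    ... | inj₁ w∈as          = ∈-++⁺ˡ w∈as
    ... | inj₂ (here refl)   = contradiction refl (All.lookup u∉us w∈us)
    ... | inj₂ (there w∈bs)  = ∈-++⁺ʳ as w∈bs

  length*≤sum : ∀ {c us} → All (λ u → c ≤ g u) us → length us * c ≤ sum (map g us)
  length*≤sum []       = z≤n
  length*≤sum (p ∷ ps) = +-mono-≤ p (length*≤sum ps)

  sum≤length* : ∀ {c us} → All (λ u → g u ≤ c) us → sum (map g us) ≤ length us * c
  sum≤length* []       = z≤n
  sum≤length* (p ∷ ps) = +-mono-≤ p (sum≤length* ps)

  1≤sum⇒∃ : ∀ us → 1 ≤ sum (map g us) → ∃[ u ] u ∈ us × 1 ≤ g u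
  1≤sum⇒∃ (u ∷ us) le with g u in eq
  ... | suc _ = u , here refl , subst (1 ≤_) (sym eq) (s≤s z≤n)
  ... | zero with 1≤sum⇒∃ us le
  ...   | w , w∈us , 1≤gw = w , there w∈us , 1≤gw

  ∈⇒≤sum : ∀ {u us} → u ∈ us → g u ≤ sum (map g us)
  ∈⇒≤sum (here refl)  = m≤m+n _ _
  ∈⇒≤sum (there u∈us) = ≤-trans (∈⇒≤sum u∈us) (m≤n+m _ _)

-- Subsets of Fin n

Meets : ∀ {n} → Subset n → Subset n → Set
Meets p q = Nonempty (p ∩ q)

Meets-mono : ∀ {n} {p p′ : Subset n} (q : Subset n) → p ⊆ p′ → Meets p q → Meets p′ q
Meets-mono q p⊆p′ (x , x∈) with x∈p∩q⁻ _ q x∈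
... | x∈p , x∈q = x , x∈p∩q⁺ (p⊆p′ x∈p , x∈q)

∈⇒⁅x⁆∪-meets : ∀ {n} {x : Fin n} (p : Subset n) {q : Subset n} → x ∈ₛ q → Meets (⁅ x ⁆ ∪ p) q
∈⇒⁅x⁆∪-meets {x = x} p x∈q = x , x∈p∩q⁺ (p⊆p∪q p (x∈⁅x⁆ x) , x∈q)

0<∣p∣⇒Nonempty : ∀ {n} (p : Subset n) → 0 < ∣ p ∣ → Nonempty p
0<∣p∣⇒Nonempty {n} p 0<∣p∣ = decidable-stable (nonempty? p) λ empty →
  <⇒≢ 0<∣p∣ (sym (trans (cong ∣_∣ (Empty-unique empty)) (∣⊥∣≡0 n)))

1<∣p∣⇒two-elements : ∀ {n} (p : Subset n) → 1 < ∣ p ∣ →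
  ∃[ x ] ∃[ y ] x ≢ y × x ∈ₛ p × y ∈ₛ p
1<∣p∣⇒two-elements (inside ∷ p) (s≤s 0<∣p∣) with 0<∣p∣⇒Nonempty p 0<∣p∣
... | y , y∈p = zero , suc y , (λ ()) , here , there y∈p
1<∣p∣⇒two-elements (outside ∷ p) lt with 1<∣p∣⇒two-elements p lt
... | x , y , x≢y , x∈p , y∈p =
  suc x , suc y , x≢y ∘ Fin.suc-injective , there x∈p , there y∈p

∣⁅x⁆∪p∣≤1+∣p∣ : ∀ {n} (x : Fin n) (p : Subset n) → ∣ ⁅ x ⁆ ∪ p ∣ ≤ suc ∣ p ∣
∣⁅x⁆∪p∣≤1+∣p∣ zero    (inside  ∷ p) rewrite ∪-identityˡ p = n≤1+n _
∣⁅x⁆∪p∣≤1+∣p∣ zero    (outside ∷ p) rewrite ∪-identityˡ p = ≤-refl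
∣⁅x⁆∪p∣≤1+∣p∣ (suc x) (inside  ∷ p) = s≤s (∣⁅x⁆∪p∣≤1+∣p∣ x p)
∣⁅x⁆∪p∣≤1+∣p∣ (suc x) (outside ∷ p) = ∣⁅x⁆∪p∣≤1+∣p∣ x p

x∉p⇒∣⁅x⁆∪p∣≡1+∣p∣ : ∀ {n} (x : Fin n) (p : Subset n) → x ∉ₛ p → ∣ ⁅ x ⁆ ∪ p ∣ ≡ suc ∣ p ∣
x∉p⇒∣⁅x⁆∪p∣≡1+∣p∣ zero    (inside  ∷ p) x∉p = contradiction here x∉p
x∉p⇒∣⁅x⁆∪p∣≡1+∣p∣ zero    (outside ∷ p) x∉p rewrite ∪-identityˡ p = refl
x∉p⇒∣⁅x⁆∪p∣≡1+∣p∣ (suc x) (inside  ∷ p) x∉p = cong suc (x∉p⇒∣⁅x⁆∪p∣≡1+∣p∣ x p (x∉p ∘ there))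
x∉p⇒∣⁅x⁆∪p∣≡1+∣p∣ (suc x) (outside ∷ p) x∉p = x∉p⇒∣⁅x⁆∪p∣≡1+∣p∣ x p (x∉p ∘ there)

superset-of-size : ∀ {n m} (p : Subset n) → ∣ p ∣ ≤ m → m ≤ n → ∃[ q ] p ⊆ q × ∣ q ∣ ≡ m
superset-of-size [] _ z≤n = [] , (λ x∈ → x∈) , refl
superset-of-size {m = suc m} (inside ∷ p) (s≤s ∣p∣≤m) (s≤s m≤n)
  with superset-of-size p ∣p∣≤m m≤n
... | q , p⊆q , e = inside ∷ q , s⊆s p⊆q , cong suc e
superset-of-size {suc n} {m} (outside ∷ p) ∣p∣≤m m≤1+n with m ≤? n
-- Here `m` is `suc n`, so the head must be added although `p` leaves it out.
... | no m≰n = ⊤ , ⊆⊤ , trans (∣⊤∣≡n (suc n)) (≤-antisym (≰⇒> m≰n) m≤1+n)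
... | yes m≤n with superset-of-size p ∣p∣≤m m≤n
...   | q , p⊆q , e = outside ∷ q , s⊆s p⊆q , e

-- k-subsets

infix 4 _≟ᴷ_
_≟ᴷ_ : ∀ {n k} → DecidableEquality (KSubset n k)
s ≟ᴷ t = map′ KSubset-≡ (cong proj₁) (≡-dec _≟ᵇ_ (proj₁ s) (proj₁ t))

DisjointK : ∀ {n k} → KSubset n k → KSubset n k → Set
DisjointK s t = Empty (proj₁ s ∩ proj₁ t)

insert : ∀ {n m} (x : Fin n) (s : KSubset n m) → x ∉ₛ proj₁ s → KSubset n (suc m)
insert x (p , e) x∉p = ⁅ x ⁆ ∪ p , trans (x∉p⇒∣⁅x⁆∪p∣≡1+∣p∣ x p x∉p) (cong suc e)

insert-injective : ∀ {n m} {x y} (s : KSubset n m) (x∉s : x ∉ₛ proj₁ s) (y∉s : y ∉ₛ proj₁ s) →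
  insert x s x∉s ≡ insert y s y∉s → x ≡ y
insert-injective {x = x} {y} (p , _) x∉p _ eq
  with x∈p∪q⁻ ⁅ y ⁆ p (subst (x ∈ₛ_) (cong proj₁ eq) (p⊆p∪q p (x∈⁅x⁆ x)))
... | inj₁ x∈⁅y⁆ = x∈⁅y⁆⇒x≡y y x∈⁅y⁆
... | inj₂ x∈p   = contradiction x∈p x∉p

-- The covers of `p` in the inclusion order: each `outside` entry is switched to `inside` once.
upperCovers : ∀ {n m} (p : Subset n) → ∣ p ∣ ≡ m → List (KSubset n (suc m))
upperCovers [] _ = []
upperCovers (outside ∷ p) e = (inside ∷ p , cong suc e) ∷ map consOut (upperCovers p e)
upperCovers {m = suc m} (inside ∷ p) e = map consIn (upperCovers p (suc-injective e))

-- There is one cover per point missing from `p`; the additive form avoids truncated subtraction.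
length-upperCovers : ∀ {n m} (p : Subset n) (e : ∣ p ∣ ≡ m) → m + length (upperCovers p e) ≡ n
length-upperCovers [] refl = refl
length-upperCovers {m = m} (outside ∷ p) e
  rewrite length-map consOut (upperCovers p e) =
  trans (+-suc m _) (cong suc (length-upperCovers p e))
length-upperCovers {m = suc m} (inside ∷ p) e
  rewrite length-map consIn (upperCovers p (suc-injective e)) =
  cong suc (length-upperCovers p (suc-injective e))

upperCovers-unique : ∀ {n m} (p : Subset n) (e : ∣ p ∣ ≡ m) → Unique (upperCovers p e)
upperCovers-unique [] _ = []
upperCovers-unique (outside ∷ p) e =
  All.map⁺ (All.universal (λ _ ()) _) ∷ Unique.map⁺ consOut-injective (upperCovers-unique p e)
upperCovers-unique {m = suc m} (inside ∷ p) e =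
  Unique.map⁺ consIn-injective (upperCovers-unique p (suc-injective e))

upperCovers-⊇ : ∀ {n m} (p : Subset n) (e : ∣ p ∣ ≡ m) →
  All (λ t → p ⊆ proj₁ t) (upperCovers p e)
upperCovers-⊇ [] _ = []
upperCovers-⊇ (outside ∷ p) e = out⊆ (λ x∈p → x∈p) ∷ All.map⁺ (All.map s⊆s (upperCovers-⊇ p e))
upperCovers-⊇ {m = suc m} (inside ∷ p) e =
  All.map⁺ (All.map s⊆s (upperCovers-⊇ p (suc-injective e)))

-- Transversals of families of k-sets, with k = `suc m`

module _ {n m : ℕ} where

  private
    K : Set
    K = KSubset n (suc m)

  MeetsAll : Subset n → List K → Set
  MeetsAll p = All (Meets p ∘ proj₁)

  MeetsAll-mono : ∀ {p q us} → p ⊆ q → MeetsAll p us → MeetsAll q us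
  MeetsAll-mono p⊆q = All.map (λ {u} → Meets-mono (proj₁ u) p⊆q)

  -- Induction step common to both transversal constructions. The size is only bounded, since `x`
  -- may already lie in `p`.
  transversal-∷ : ∀ {x p l} (u : K) {us} → x ∈ₛ proj₁ u → ∣ p ∣ ≤ l → MeetsAll p us →
    ∣ ⁅ x ⁆ ∪ p ∣ ≤ suc l × MeetsAll (⁅ x ⁆ ∪ p) (u ∷ us)
  transversal-∷ {x} {p} u x∈u ∣p∣≤l meets =
    ≤-trans (∣⁅x⁆∪p∣≤1+∣p∣ x p) (s≤s ∣p∣≤l) ,
    ∈⇒⁅x⁆∪-meets p x∈u ∷ MeetsAll-mono (q⊆p∪q ⁅ x ⁆ p) meets

  vertex-nonempty : (u : K) → Nonempty (proj₁ u)
  vertex-nonempty (p , e) = 0<∣p∣⇒Nonempty p (subst (0 <_) (sym e) (s≤s z≤n))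

  transversal : (us : List K) → ∃[ p ] ∣ p ∣ ≤ length us × MeetsAll p us
  transversal [] = ⊥ , ≤-reflexive (∣⊥∣≡0 n) , []
  transversal (u ∷ us) with vertex-nonempty u | transversal us
  ... | x , x∈u | p , ∣p∣≤l , meets = ⁅ x ⁆ ∪ p , transversal-∷ u x∈u ∣p∣≤l meets

  -- The prescribed point serves as the representative of `u`, so including it costs no extra point.
  transversal-through : ∀ {x} {u : K} {us} → x ∈ₛ proj₁ u → u ∈ us →
    ∃[ p ] x ∈ₛ p × ∣ p ∣ ≤ length us × MeetsAll p us
  transversal-through {x} {us = u ∷ us} x∈u (here refl) with transversal us
  ... | p , ∣p∣≤l , meets =
    ⁅ x ⁆ ∪ p , p⊆p∪q p (x∈⁅x⁆ x) , transversal-∷ u x∈u ∣p∣≤l meets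
  transversal-through {us = v ∷ us} x∈u (there u∈us)
    with vertex-nonempty v | transversal-through x∈u u∈us
  ... | y , y∈v | p , x∈p , ∣p∣≤l , meets =
    ⁅ y ⁆ ∪ p , q⊆p∪q ⁅ y ⁆ p x∈p , transversal-∷ v y∈v ∣p∣≤l meets

  -- A point of `p` in `u` lies in no later member, so removing it from `p` leaves the later members
  -- met; each member thus uses up its own point.
  disjoint-all-met⇒length≤ : ∀ (p : Subset n) {us : List K} →
    AllPairs DisjointK us → MeetsAll p us → length us ≤ ∣ p ∣
  disjoint-all-met⇒length≤ p [] [] = z≤n
  disjoint-all-met⇒length≤ p {u ∷ us} (u~us ∷ disj) ((x , x∈p∩u) ∷ meets)
    with x∈p∩q⁻ p (proj₁ u) x∈p∩u
  ... | x∈p , x∈u = ≤-trans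
    (s≤s (disjoint-all-met⇒length≤ (p - x) disj (All.zipWith (λ {v} → still-met {v}) (u~us , meets))))
    (x∈p⇒∣p-x∣<∣p∣ x∈p)
    where
    still-met : ∀ {v} → DisjointK u v × Meets p (proj₁ v) → Meets (p - x) (proj₁ v)
    still-met {v} (u~v , y , y∈p∩v) with x∈p∩q⁻ p (proj₁ v) y∈p∩v
    ... | y∈p , y∈v =
      y , x∈p∩q⁺ (x∈p∧x≢y⇒x∈p-y y∈p (λ { refl → u~v (x , x∈p∩q⁺ (x∈u , y∈v)) }) , y∈v)

  disjoint⇒unique : ∀ {us : List K} → AllPairs DisjointK us → Unique us
  disjoint⇒unique = AllPairs.map λ {u} {v} u~v u≡v → ~-irrefl {u} {v} u≡v u~v
    where open FiniteSimpleGraph (Kneser n (suc m)) using (~-irrefl)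

-- Families of pairwise disjoint k-sets

Empty-outside : ∀ {n} {p : Subset n} → Empty p → Empty (outside ∷ p)
Empty-outside empty (suc x , there x∈p) = empty (x , x∈p)

-- A partial member s is grown one point at a time until it can join the family.
growingFamily : ∀ k j i →
  ∃[ s ] ∃[ us ] length us ≡ j × AllPairs (DisjointK {i + j * k} {k}) us ×
    All (λ u → Empty (proj₁ {B = λ p → ∣ p ∣ ≡ i} s ∩ proj₁ u)) us
growingFamily k zero    zero    = ([] , refl) , [] , refl , [] , []
-- The partial member has reached size `k`: it joins the family and the empty set replaces it. The
-- ground set is unchanged, as `suc j * k` computes to `k + j * k`.
growingFamily k (suc j) zero    with growingFamily k j k
... | s , us , l , disj , s~us =
  (⊥ , ∣⊥∣≡0 (k + j * k)) , s ∷ us , cong suc l , s~us ∷ disj ,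
  All.universal (λ u (x , x∈) → ∉⊥ (proj₁ (x∈p∩q⁻ ⊥ (proj₁ u) x∈))) (s ∷ us)
growingFamily k j       (suc i) with growingFamily k j i
... | s , us , l , disj , s~us =
  consIn s , map consOut us , trans (length-map consOut us) l ,
  AllPairs.map⁺ (AllPairs.map Empty-outside disj) ,
  All.map⁺ (All.map Empty-outside s~us)

disjointFamily : ∀ {n} k j → j * k ≤ n →
  ∃[ us ] length us ≡ j × AllPairs (DisjointK {n} {k}) us
-- The surplus points of the ground set all go into the partial member, which is then discarded.
disjointFamily {n} k j j*k≤n with n ∸ j * k | m∸n+n≡m j*k≤n
... | i | refl with growingFamily k j i
...   | _ , us , l , disj , _ = us , l , disj

module _ (n m : ℕ) (1≤m : 1 ≤ m) (n-large : suc m * (suc m + 1) ≤ n) where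

  private
    G : FiniteSimpleGraph
    G = Kneser n (suc m)

    2[k+1] : ℕ
    2[k+1] = 2 * (suc m + 1)

  open FiniteSimpleGraph G
  open DecMembership (_≟ᴷ_ {n} {suc m}) using (_∈?_)

  -- Upper bound

  module Attained (us : List V) (length-us : length us ≡ suc m + 1)
                  (disj : AllPairs DisjointK us) where

    f : V → Fin 3
    f v with v ∈? us
    ... | yes _ = 2F
    ... | no _  = 0F

    f-on : ∀ {v} → v ∈ us → f v ≡ 2F
    f-on {v} v∈us with v ∈? us
    ... | yes _   = refl
    ... | no v∉us = contradiction v∈us v∉us

    f-support : ∀ {v} → toℕ (f v) ≢ 0 → v ∈ us
    f-support {v} fv≢0 with v ∈? us
    ... | yes v∈us = v∈us
    ... | no _     = contradiction refl fv≢0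

    neighbour : ∀ v → ∃[ u ] v ~ u × f u ≡ 2F
    neighbour v@(p , ∣p∣≡k) with All.all? (λ u → nonempty? (p ∩ proj₁ u)) us
    -- Meeting all k+1 disjoint members would take k+1 points.
    ... | yes meets = contradiction
      (subst₂ _≤_ (trans length-us (+-comm (suc m) 1)) ∣p∣≡k
        (disjoint-all-met⇒length≤ p disj meets))
      1+n≰n
    ... | no ¬meets
      with find (All.¬All⇒Any¬ (λ u → nonempty? (p ∩ proj₁ u)) us ¬meets)
    ...   | u , u∈us , v~u = u , v~u , f-on u∈us

    isTRDF : IsTRDF G f
    isTRDF = record { roman = λ v _ → neighbour v ; total = total }
      where
      total : ∀ v → 1 ≤ sum (map (toℕ ∘ f) (N v))
      total v with neighbour v
      ... | u , v~u , fu≡2 = ≤-trans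
        (subst (λ a → 1 ≤ toℕ a) (sym fu≡2) (s≤s z≤n))
        (∈⇒≤sum (toℕ ∘ f) (∈-filter⁺ (v ~?_) (complete u) v~u))

    weight≡ : weight G f ≡ 2[k+1]
    -- The weight equals the sum over `us`: at most, because `us` carries the support of `f`; at
    -- least, because `us` has no repeats.
    weight≡ = trans (≤-antisym
      (≤-trans (sum-mono-support g unique λ _ → f-support)
        (sum≤length* g (All.tabulate λ u∈us → ≤-reflexive (g≡2 u∈us))))
      (≤-trans (length*≤sum g (All.tabulate λ u∈us → ≤-reflexive (sym (g≡2 u∈us))))
        (sum-mono-support g (disjoint⇒unique disj) λ {u} _ _ → complete u)))
      (trans (cong (_* 2) length-us) (*-comm (suc m + 1) 2))
      where
      g : V → ℕ
      g = toℕ ∘ f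
      g≡2 : ∀ {u} → u ∈ us → g u ≡ 2
      g≡2 = cong toℕ ∘ f-on

  -- Lower bound

  module Minimal (f : V → Fin 3) (trdf : IsTRDF G f) where
    open IsTRDF trdf

    g : V → ℕ
    g = toℕ ∘ f

    sum≤weight : ∀ {us} → Unique us → sum (map g us) ≤ weight G f
    sum≤weight uniq = sum-mono-support g uniq λ {u} _ _ → complete u

    twos : List V
    twos = filter (λ v → f v Fin.≟ 2F) vertices

    twos-unique : Unique twos
    twos-unique = Unique.filter⁺ (λ v → f v Fin.≟ 2F) unique

    twos-complete : ∀ {v} → f v ≡ 2F → v ∈ twos
    twos-complete {v} = ∈-filter⁺ (λ v → f v Fin.≟ 2F) (complete v)

    twos-value : All (λ v → 2 ≤ g v) twos
    twos-value = All.map (λ fv≡2 → ≤-reflexive (cong toℕ (sym fv≡2)))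
      (All.all-filter (λ v → f v Fin.≟ 2F) vertices)

    meetsTwos⇒1≤ : ∀ v → MeetsAll (proj₁ v) twos → 1 ≤ g v
    meetsTwos⇒1≤ v meets with f v in fv≡
    ... | 1F = s≤s z≤n
    ... | 2F = s≤s z≤n
    ... | 0F with roman v fv≡
    ...   | u , v~u , fu≡2 = contradiction (All.lookup meets (twos-complete fu≡2)) v~u

    k≤n : suc m ≤ n
    k≤n = ≤-trans (m≤m*n (suc m) (suc m + 1)) n-large

    m≤n : m ≤ n
    m≤n = <⇒≤ k≤n

    star : ∀ S → ∣ S ∣ ≡ m → MeetsAll S twos → 2[k+1] ≤ weight G f
    star S ∣S∣≡m meets with superset-of-size S (≤-trans (≤-reflexive ∣S∣≡m) (n≤1+n m)) k≤n
    -- The total condition at `T` gives a positive vertex `u` disjoint from `T`, hence from the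
    -- nonempty set `S`; so `u` is not among the covers of `S`.
    ... | T , S⊆T , ∣T∣≡k with 1≤sum⇒∃ g (N (T , ∣T∣≡k)) (total (T , ∣T∣≡k))
    ...   | u , u∈N , 1≤gu = ≤-trans bound (sum≤weight (u∉covers ∷ upperCovers-unique S ∣S∣≡m))
      where
      covers : List V
      covers = upperCovers S ∣S∣≡m

      T~u : Empty (T ∩ proj₁ u)
      T~u = proj₂ (∈-filter⁻ ((T , ∣T∣≡k) ~?_) {xs = vertices} u∈N)

      ¬S⊆u : ¬ S ⊆ proj₁ u
      ¬S⊆u S⊆u with 0<∣p∣⇒Nonempty S (subst (0 <_) (sym ∣S∣≡m) 1≤m)
      ... | x , x∈S = T~u (x , x∈p∩q⁺ (S⊆T x∈S , S⊆u x∈S))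

      u∉covers : All (u ≢_) covers
      u∉covers = All.map {P = λ v → S ⊆ proj₁ v} (λ S⊆v u≡v → ¬S⊆u (subst (λ w → S ⊆ proj₁ w) (sym u≡v) S⊆v))
        (upperCovers-⊇ S ∣S∣≡m)

      covers-value : All (λ v → 1 ≤ g v) covers
      covers-value = All.map {P = λ v → S ⊆ proj₁ v} (λ {v} S⊆v → meetsTwos⇒1≤ v (MeetsAll-mono S⊆v meets))
        (upperCovers-⊇ S ∣S∣≡m)

      arith : ∀ {m n l} → 1 ≤ m → suc m * (suc m + 1) ≤ n → m + l ≡ n →
        2 * (suc m + 1) ≤ 1 + l * 1
      -- Adding `m` to both sides turns the claim into m + 2(k+1) ≤ n + 1. With `m = suc a`, the
      -- bound on `n` gives this with `a * a + 2 * a` to spare.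
      arith {suc a} {_} {l} _ le refl = +-cancelˡ-≤ (suc a) _ _
        (≤-trans (≤-trans (m≤m+n _ (a * a + 2 * a)) (≤-reflexive (expand a)))
          (≤-trans (s≤s le) (≤-reflexive (regroup a l))))
        where
        expand : ∀ a → suc a + 2 * (suc (suc a) + 1) + (a * a + 2 * a) ≡
          suc (suc (suc a) * (suc (suc a) + 1))
        expand = solve-∀
        regroup : ∀ a l → suc (suc a + l) ≡ suc a + (1 + l * 1)
        regroup = solve-∀

      bound : 2[k+1] ≤ sum (map g (u ∷ covers))
      bound = ≤-trans (arith 1≤m n-large (length-upperCovers S ∣S∣≡m))
        (+-mono-≤ 1≤gu (length*≤sum g covers-value))

    small-transversal : ∀ p → ∣ p ∣ ≤ m → MeetsAll p twos → 2[k+1] ≤ weight G f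
    small-transversal p ∣p∣≤m meets with superset-of-size p ∣p∣≤m m≤n
    ... | S , p⊆S , ∣S∣≡m = star S ∣S∣≡m (MeetsAll-mono p⊆S meets)

    exactly-k-twos : ∀ A R → twos ≡ A ∷ R → length R ≡ m → 2[k+1] ≤ weight G f
    exactly-k-twos A R twos≡ ∣R∣≡m
      with Any.any? (λ B → nonempty? (proj₁ A ∩ proj₁ B)) R
    ... | yes A-meets-R with find A-meets-R
    ...   | B , B∈R , x , x∈A∩B with x∈p∩q⁻ (proj₁ A) (proj₁ B) x∈A∩B
    -- A transversal of `R` through the common point `x` also meets `A`, so `m` points suffice for
    -- all k sets.
    ...     | x∈A , x∈B with transversal-through x∈B B∈R
    ...       | p , x∈p , ∣p∣≤ , meets = small-transversal p (≤-trans ∣p∣≤ (≤-reflexive ∣R∣≡m))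
      (subst (MeetsAll p) (sym twos≡) ((x , x∈p∩q⁺ (x∈p , x∈A)) ∷ meets))
    exactly-k-twos A R twos≡ ∣R∣≡m | no A~R with transversal R
    ... | p , ∣p∣≤ , meets-p with superset-of-size p (≤-trans ∣p∣≤ (≤-reflexive ∣R∣≡m)) m≤n
    ...   | S , p⊆S , ∣S∣≡m with nonempty? (S ∩ proj₁ A)
    ...     | yes S-meets-A = star S ∣S∣≡m
      (subst (MeetsAll S) (sym twos≡) (S-meets-A ∷ MeetsAll-mono p⊆S meets-p))
    ...     | no S~A
      with 1<∣p∣⇒two-elements (proj₁ A) (subst (1 <_) (sym (proj₂ A)) (s≤s 1≤m))
    ...       | x , y , x≢y , x∈A , y∈A = ≤-trans bound (sum≤weight extended-unique)
      where
      ∉S : ∀ {z} → z ∈ₛ proj₁ A → z ∉ₛ S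
      ∉S {z} z∈A z∈S = S~A (z , x∈p∩q⁺ (z∈S , z∈A))

      S+ : ∀ {z} → z ∈ₛ proj₁ A → V
      S+ {z} z∈A = insert z (S , ∣S∣≡m) (∉S z∈A)

      S+-value : ∀ {z} (z∈A : z ∈ₛ proj₁ A) → 1 ≤ g (S+ z∈A)
      S+-value {z} z∈A = meetsTwos⇒1≤ (S+ z∈A) (subst (MeetsAll (proj₁ (S+ z∈A))) (sym twos≡)
        (∈⇒⁅x⁆∪-meets S z∈A ∷ MeetsAll-mono (q⊆p∪q ⁅ z ⁆ S ∘ p⊆S) meets-p))

      -- The new vertex is not `A`, since it contains the nonempty set `S` disjoint from `A`; it is
      -- not in `R`, since it contains a point of `A`.
      S+∉twos : ∀ {z} (z∈A : z ∈ₛ proj₁ A) → S+ z∈A ∉ A ∷ R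
      S+∉twos {z} z∈A (here S+z≡A) with 0<∣p∣⇒Nonempty S (subst (0 <_) (sym ∣S∣≡m) 1≤m)
      ... | w , w∈S = S~A (w , x∈p∩q⁺
        (w∈S , subst (λ v → w ∈ₛ proj₁ v) S+z≡A (q⊆p∪q ⁅ z ⁆ S w∈S)))
      S+∉twos {z} z∈A (there S+z∈R) =
        A~R (lose S+z∈R (z , x∈p∩q⁺ (z∈A , p⊆p∪q S (x∈⁅x⁆ z))))

      S+-distinct : S+ x∈A ≢ S+ y∈A
      S+-distinct = x≢y ∘ insert-injective (S , ∣S∣≡m) (∉S x∈A) (∉S y∈A)

      extended-unique : Unique (S+ x∈A ∷ S+ y∈A ∷ A ∷ R)
      extended-unique =
        (S+-distinct ∷ All.¬Any⇒All¬ _ (S+∉twos x∈A)) ∷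
        All.¬Any⇒All¬ _ (S+∉twos y∈A) ∷
        subst Unique twos≡ twos-unique

      -- The two new vertices count at least 1 each, the k vertices of value 2 count 2 each.
      arith : ∀ m → 2 * (suc m + 1) ≡ 1 + (1 + suc m * 2)
      arith = solve-∀

      bound : 2[k+1] ≤ sum (map g (S+ x∈A ∷ S+ y∈A ∷ A ∷ R))
      bound = ≤-trans
        (≤-reflexive (trans (arith m) (cong (λ l → 1 + (1 + suc l * 2)) (sym ∣R∣≡m))))
        (+-mono-≤ (S+-value x∈A) (+-mono-≤ (S+-value y∈A)
          (length*≤sum g (subst (All _) twos≡ twos-value))))

    minimal : 2[k+1] ≤ weight G f
    minimal with length twos ≤? m
    ... | yes few with transversal twos
    ...   | p , ∣p∣≤ , meets = small-transversal p (≤-trans ∣p∣≤ few) meets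
    minimal | no ¬few with suc m + 1 ≤? length twos
    ... | yes many = ≤-trans (≤-reflexive (*-comm 2 (suc m + 1)))
      (≤-trans (*-monoˡ-≤ 2 many)
        (≤-trans (length*≤sum g twos-value) (sum≤weight twos-unique)))
    ... | no ¬many = split twos refl
      (≤-antisym (s≤s⁻¹ (subst (length twos <_) (+-comm (suc m) 1) (≰⇒> ¬many))) (≰⇒> ¬few))
      where
      -- The list is generalised to `us` so that it can be matched while its equality with `twos` is
      -- kept.
      split : ∀ us → twos ≡ us → length us ≡ suc m → 2[k+1] ≤ weight G f
      split (A ∷ R) twos≡ l = exactly-k-twos A R twos≡ (suc-injective l)

theorem2 : (n k : ℕ) → .{{_ : NonZero n}} → .{{_ : NonZero k}} →
    1 < k → n ≥ k * (k + 1) →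
    γtR≡ (Kneser n k) (2 * (k + 1))
theorem2 n (suc m) (s≤s 1≤m) n≥
  with disjointFamily (suc m) (suc m + 1)
         (≤-trans (≤-reflexive (*-comm (suc m + 1) (suc m))) n≥)
... | us , length-us , disj = record
  { attained = f , isTRDF , weight≡
  ; minimal  = λ f trdf → Minimal.minimal n m 1≤m n≥ f trdf
  }
  where open Attained n m 1≤m n≥ us length-us disj
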